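{- For every convex-round graph $G$ with at least one edge, we have $\chi_{\mathrm{pcf}}(G)\le 9\chi(G)-12$.
   Context: Graphs are finite and simple. A graph is convex-round if its vertices have a circular ordering such that the (open) neighborhood of every vertex is an interval (a set of consecutive vertices) of the circular ordering. $\chi(G)$ is the chromatic number. A proper conflict-free coloring of $G$ is a proper vertex coloring in which, for every non-isolated vertex $v$, some color appears exactly once in the open neighborhood $N(v)$. $\chi_{\mathrm{pcf}}(G)$ is the least $k$ such that $G$ has a proper conflict-free coloring with $k$ colors. -}

module Defs where

open import Data.Fin using (Fin; zero; suc; toℕ)
open import Data.Fin.Permutation using (Permutation′; _⟨$⟩ʳ_)
open import Data.Fin.Properties using (_≟_; any?; all?; nonZeroIndex)
open import Data.Nat using (ℕ; zero; suc; _+_; _≤_; _<_; z≤n; s≤s)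
open import Data.Nat.DivMod using (_mod_)
open import Data.Product using (_×_; ∃; ∃!; ∃₂; _,_; proj₁)
open import Data.Vec.Functional using (_∷_; head; tail)
open import Function using (_∘_; id)
open import Level using (0ℓ)
open import Relation.Binary using (Rel; Symmetric; Irreflexive)
import Relation.Binary as Binary
open import Relation.Binary.PropositionalEquality
  using (_≡_; _≢_; _≗_; refl; sym; trans)
open import Relation.Nullary using (Dec; yes; no; contradiction)
open import Relation.Nullary.Decidable using (map′; _×-dec_; _→-dec_; ¬?)
open import Relation.Unary using (Pred; Decidable; _≐_)

------------------------------------------------------------------------
-- Graphs

record Graph (n : ℕ) : Set₁ where
  infix 4 _~_ _~?_
  field
    _~_      : Rel (Fin n) 0ℓ
    _~?_     : Binary.Decidable _~_
    ~-sym    : Symmetric _~_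
    ~-irrefl : Irreflexive _≡_ _~_

  N : Fin n → Pred (Fin n) 0ℓ
  N v u = v ~ u

  NonIsolated : Pred (Fin n) 0ℓ
  NonIsolated v = ∃ (N v)

HasEdge : ∀ {n} → Graph n → Set
HasEdge G = ∃₂ λ u v → u ~ v
  where open Graph G

------------------------------------------------------------------------
-- Convex-round graphs

advance : ∀ {n} → Fin n → ℕ → Fin n
advance {n} s t = _mod_ (toℕ s + t) n {{nonZeroIndex s}}

-- A circular ordering is a permutation π, where π ⟨$⟩ʳ i is the vertex
-- at position i and positions are read modulo n.  The interval with
-- starting position s and length ℓ consists of the vertices at positions
-- s, s + 1, …, s + ℓ - 1 (mod n).  The empty set (ℓ = 0) and the whole
-- vertex set (ℓ ≥ n) are intervals.
IsInterval : ∀ {n} → Permutation′ n → Pred (Fin n) 0ℓ → Set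
IsInterval π S =
  ∃₂ λ s ℓ → S ≐ λ v → ∃ λ t → t < ℓ × π ⟨$⟩ʳ advance s t ≡ v

ConvexRound : ∀ {n} → Graph n → Set
ConvexRound {n} G = ∃ λ (π : Permutation′ n) → ∀ v → IsInterval π (N v)
  where open Graph G

------------------------------------------------------------------------
-- Colorings

Coloring : ℕ → ℕ → Set
Coloring n k = Fin n → Fin k

module _ {n} (G : Graph n) where
  open Graph G

  Proper : ∀ {k} → Coloring n k → Set
  Proper c = ∀ u v → u ~ v → c u ≢ c v

  ConflictFree : ∀ {k} → Coloring n k → Set
  ConflictFree c =
    ∀ v → NonIsolated v → ∃ λ a → ∃! _≡_ λ u → N v u × c u ≡ a

  ProperConflictFree : ∀ {k} → Coloring n k → Set
  ProperConflictFree c = Proper c × ConflictFree c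

  Colorable : ℕ → Set
  Colorable k = ∃ λ (c : Coloring n k) → Proper c

  PCFColorable : ℕ → Set
  PCFColorable k = ∃ λ (c : Coloring n k) → ProperConflictFree c

------------------------------------------------------------------------
-- Decidability of colorability

anyFunction? : ∀ {n k} {P : Pred (Fin n → Fin k) 0ℓ} →
               (∀ {f g} → f ≗ g → P f → P g) → Decidable P → Dec (∃ P)
anyFunction? {zero} resp P? =
  map′ (λ p → _ , p) (λ (f , p) → resp (λ ()) p) (P? λ ())
anyFunction? {suc n} {P = P} resp P? =
  map′ (λ (a , f , p) → a ∷ f , p)
       (λ (f , p) → head f , tail f , resp (η f) p)
       (any? λ a → anyFunction? (resp ∘ ∷-cong a) (P? ∘ (a ∷_)))
  where
  η : ∀ f → f ≗ head f ∷ tail f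
  η f zero    = refl
  η f (suc i) = refl

  ∷-cong : ∀ a {f g} → f ≗ g → (a ∷ f) ≗ (a ∷ g)
  ∷-cong a eq zero    = refl
  ∷-cong a eq (suc i) = eq i

module _ {n} (G : Graph n) where
  open Graph G

  proper? : ∀ {k} → Decidable (Proper G {k})
  proper? c = all? λ u → all? λ v → (u ~? v) →-dec ¬? (c u ≟ c v)

  conflictFree? : ∀ {k} → Decidable (ConflictFree G {k})
  conflictFree? c =
    all? λ v → any? (v ~?_) →-dec any? λ a → any? λ u →
      has? v a u ×-dec
      map′ (λ h {w} → h w) (λ h w → h {w})
           (all? λ w → has? v a w →-dec (u ≟ w))
    where
    has? : ∀ v a → Decidable (λ u → N v u × c u ≡ a)
    has? v a u = (v ~? u) ×-dec (c u ≟ a)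

  proper-resp : ∀ {k} {c d : Coloring n k} →
                c ≗ d → Proper G c → Proper G d
  proper-resp eq p u v uv du≡dv =
    p u v uv (trans (eq u) (trans du≡dv (sym (eq v))))

  conflictFree-resp : ∀ {k} {c d : Coloring n k} →
                      c ≗ d → ConflictFree G c → ConflictFree G d
  conflictFree-resp eq p v nv with p v nv
  ... | a , u , (vu , cu≡a) , unique =
    a , u , (vu , trans (sym (eq u)) cu≡a) ,
    λ {w} (vw , dw≡a) → unique (vw , trans (eq w) dw≡a)

  colorable? : Decidable (Colorable G)
  colorable? k = anyFunction? proper-resp proper?

  pcfColorable? : Decidable (PCFColorable G)
  pcfColorable? k = anyFunction?
    (λ eq (p , q) → proper-resp eq p , conflictFree-resp eq q)
    (λ c → proper? c ×-dec conflictFree? c)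

  id-proper : Proper G id
  id-proper u v uv u≡v = ~-irrefl u≡v uv

  id-conflictFree : ConflictFree G id
  id-conflictFree v (u , vu) = u , u , (vu , refl) , λ (_ , w≡u) → sym w≡u

------------------------------------------------------------------------
-- Chromatic numbers

Least : Pred ℕ 0ℓ → Set
Least P = ∃ λ m → P m × (∀ j → P j → m ≤ j)

least : ∀ {P : Pred ℕ 0ℓ} → Decidable P → ∀ b → P b → Least P
least P? zero    p = zero , p , λ _ _ → z≤n
least P? (suc b) p with P? zero
... | yes p₀ = zero , p₀ , λ _ _ → z≤n
... | no ¬p₀ with least (P? ∘ suc) b p
...   | m , q , min = suc m , q ,
        λ { zero r → contradiction r ¬p₀ ; (suc j) r → s≤s (min j r) }

module _ {n} (G : Graph n) where

  χ-least : Least (Colorable G)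
  χ-least = least (colorable? G) n (id , id-proper G)

  χpcf-least : Least (PCFColorable G)
  χpcf-least =
    least (pcfColorable? G) n (id , id-proper G , id-conflictFree G)

  χ : ℕ
  χ = proj₁ χ-least

  χpcf : ℕ
  χpcf = proj₁ χpcf-least

{-# OPTIONS --safe #-}
module Submission where

-- Let P be a minimal set meeting every nonempty neighborhood.  Every p in P
-- has a private neighbor, whose only neighbor in P is p.  If some N(v) contained
-- three points of P, their private neighbors would have a middle one as seen
-- from v, and no interval contains v and that one but neither of the others;
-- so N(v) has one or two points in P, and two such points are consecutive in
-- P.  Given a proper k-coloring c, refine it by 0 off P and by an alternating
-- mark 1, 2 on P: then any point of P in N(v) has a unique color there.
-- Alternation must only separate points of equal color under c, and P is not
-- monochromatic, so for each color one can cut the circle at a point of P of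
-- another color.  This gives 3k ≤ 9k - 12 colors, as k ≥ 2.

open import Defs
open import Data.Bool using (Bool; true; false; not; _xor_)
open import Data.Bool.Properties using (not-¬)
open import Data.Fin using (Fin; zero; suc; toℕ; combine)
open import Data.Fin.Permutation
  using (Permutation′; _⟨$⟩ʳ_; _⟨$⟩ˡ_; inverseˡ; inverseʳ)
open import Data.Fin.Properties
  using (_≟_; any?; all?; nonZeroIndex; toℕ-injective; toℕ-fromℕ<; toℕ<n;
         toℕ≤n; combine-injective; ¬∀⟶∃¬)
open import Data.Fin.Subset
  using (Subset; ⊤; ∣_∣; _-_) renaming (_∈_ to _∈ₛ_)
open import Data.Fin.Subset.Properties
  using (_∈?_; ∈⊤; ∣⊤∣≡n; anySubset?; x∈p∧x≢y⇒x∈p-y; x∈p⇒∣p-x∣<∣p∣)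
open import Data.Nat
  using (ℕ; zero; suc; _+_; _*_; _∸_; _%_; _≤_; _<_; z≤n; s≤s; NonZero)
open import Data.Nat.DivMod
  using (m%n<n; m%n%n≡m%n; [m+n]%n≡m%n; m<n⇒m%n≡m; m%n≤m; m≤n⇒[n∸m]%m≡n%m;
         %-distribˡ-+)
import Data.Nat as ℕ
open import Data.Nat.Properties hiding (_≟_)
open import Data.Product using (_×_; ∃; ∃₂; _,_; proj₁; proj₂)
open import Data.Sum using (_⊎_; inj₁; inj₂; swap)
open import Function using (_∘_)
open import Level using (0ℓ)
open import Relation.Binary.Definitions using (tri<; tri≈; tri>)
open import Relation.Binary.PropositionalEquality
open import Relation.Nullary using (yes; no; does; ¬_; contradiction)
open import Relation.Nullary.Decidable
  using (_×-dec_; _→-dec_; ¬?; decidable-stable; dec-true; dec-false)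
open import Relation.Unary using (Pred; Decidable)

-- Betweenness of numbers

Between : ℕ → ℕ → ℕ → Set
Between a b c = (a < b × b < c) ⊎ (c < b × b < a)

one-between : ∀ {a b c} → a ≢ b → b ≢ c → a ≢ c →
              Between b a c ⊎ Between a b c ⊎ Between a c b
one-between {a} {b} {c} a≢b b≢c a≢c with <-cmp a b | <-cmp b c | <-cmp a c
... | tri≈ _ eq _ | _ | _ = contradiction eq a≢b
... | _ | tri≈ _ eq _ | _ = contradiction eq b≢c
... | _ | _ | tri≈ _ eq _ = contradiction eq a≢c
... | tri< p _ _ | tri< q _ _ | _ = inj₂ (inj₁ (inj₁ (p , q)))
... | tri> _ _ p | tri> _ _ q | _ = inj₂ (inj₁ (inj₂ (q , p)))
... | tri< p _ _ | tri> _ _ q | tri< r _ _ = inj₂ (inj₂ (inj₁ (r , q)))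
... | tri< p _ _ | tri> _ _ q | tri> _ _ r = inj₁ (inj₂ (r , p))
... | tri> _ _ p | tri< q _ _ | tri< r _ _ = inj₁ (inj₁ (p , r))
... | tri> _ _ p | tri< q _ _ | tri> _ _ r = inj₂ (inj₂ (inj₂ (q , r)))

-- Circular offsets

module _ {n} .{{_ : NonZero n}} where

  -- The number of forward steps from `s` to `x` around the circle; adding `n ∸ toℕ s` amounts to
  -- subtracting `s` modulo `n`.
  offset : Fin n → Fin n → ℕ
  offset s x = (toℕ x + (n ∸ toℕ s)) % n

  offset<n : ∀ s x → offset s x < n
  offset<n s x = m%n<n (toℕ x + (n ∸ toℕ s)) n

  %-absorbˡ : ∀ m k → (m % n + k) % n ≡ (m + k) % n
  %-absorbˡ m k = begin
    (m % n + k) % n            ≡⟨ %-distribˡ-+ (m % n) k n ⟩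
    (m % n % n + k % n) % n    ≡⟨ cong (λ i → (i + k % n) % n) (m%n%n≡m%n m n) ⟩
    (m % n + k % n) % n        ≡⟨ %-distribˡ-+ m k n ⟨
    (m + k) % n                ∎
    where open ≡-Reasoning

  toℕ-advance : ∀ (s : Fin n) t → toℕ (advance s t) ≡ (toℕ s + t) % n
  toℕ-advance s t = toℕ-fromℕ< (m%n<n (toℕ s + t) n {{nonZeroIndex s}})

  advance-+ : ∀ (s : Fin n) i j → advance (advance s i) j ≡ advance s (i + j)
  advance-+ s i j = toℕ-injective (begin
    toℕ (advance (advance s i) j)   ≡⟨ toℕ-advance (advance s i) j ⟩
    (toℕ (advance s i) + j) % n     ≡⟨ cong (λ k → (k + j) % n) (toℕ-advance s i) ⟩
    ((toℕ s + i) % n + j) % n       ≡⟨ %-absorbˡ (toℕ s + i) j ⟩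
    (toℕ s + i + j) % n             ≡⟨ cong (_% n) (+-assoc (toℕ s) i j) ⟩
    (toℕ s + (i + j)) % n           ≡⟨ toℕ-advance s (i + j) ⟨
    toℕ (advance s (i + j))         ∎)
    where open ≡-Reasoning

  offset-advance : ∀ s t → offset s (advance s t) ≡ t % n
  offset-advance s t = begin
    (toℕ (advance s t) + c) % n     ≡⟨ cong (λ k → (k + c) % n) (toℕ-advance s t) ⟩
    ((toℕ s + t) % n + c) % n       ≡⟨ %-absorbˡ (toℕ s + t) c ⟩
    (toℕ s + t + c) % n             ≡⟨ cong (λ k → (k + c) % n) (+-comm (toℕ s) t) ⟩
    (t + toℕ s + c) % n             ≡⟨ cong (_% n) (+-assoc t (toℕ s) c) ⟩
    (t + (toℕ s + c)) % n           ≡⟨ cong (λ k → (t + k) % n) (m+[n∸m]≡n (toℕ≤n s)) ⟩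
    (t + n) % n                     ≡⟨ [m+n]%n≡m%n t n ⟩
    t % n                           ∎
    where
    open ≡-Reasoning
    c = n ∸ toℕ s

  advance-offset : ∀ (s x : Fin n) → advance s (offset s x) ≡ x
  advance-offset s x = toℕ-injective (begin
    toℕ (advance s (offset s x))    ≡⟨ toℕ-advance s (offset s x) ⟩
    (toℕ s + offset s x) % n        ≡⟨ cong (_% n) (+-comm (toℕ s) _) ⟩
    (offset s x + toℕ s) % n        ≡⟨ %-absorbˡ (toℕ x + c) (toℕ s) ⟩
    (toℕ x + c + toℕ s) % n         ≡⟨ cong (_% n) (+-assoc (toℕ x) c (toℕ s)) ⟩
    (toℕ x + (c + toℕ s)) % n       ≡⟨ cong (λ k → (toℕ x + k) % n) (m∸n+n≡m (toℕ≤n s)) ⟩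
    (toℕ x + n) % n                 ≡⟨ [m+n]%n≡m%n (toℕ x) n ⟩
    toℕ x % n                       ≡⟨ m<n⇒m%n≡m (toℕ<n x) ⟩
    toℕ x                           ∎)
    where
    open ≡-Reasoning
    c = n ∸ toℕ s

  offset-rebase : ∀ s q x → offset s x ≡ (offset s q + offset q x) % n
  offset-rebase s q x = begin
    offset s x                                        ≡⟨ cong (offset s) (advance-offset q x) ⟨
    offset s (advance q e)                            ≡⟨ cong (λ r → offset s (advance r e)) (advance-offset s q) ⟨
    offset s (advance (advance s (offset s q)) e)     ≡⟨ cong (offset s) (advance-+ s (offset s q) e) ⟩
    offset s (advance s (offset s q + e))             ≡⟨ offset-advance s (offset s q + e) ⟩
    (offset s q + e) % n                              ∎
    where
    open ≡-Reasoning
    e = offset q x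

  -- Both summands are below `n`, so going from `s` to `x` by way of `q` makes at most one extra
  -- full turn. It does so when the walk from `q` reaches `s` again.
  offset-split : ∀ s q x → offset s q + offset q x ≡ offset s x ⊎
                           offset s q + offset q x ≡ offset s x + n
  offset-split s q x with offset s q + offset q x ℕ.<? n
  ... | yes a+e<n = inj₁ (sym (trans (offset-rebase s q x) (m<n⇒m%n≡m a+e<n)))
  ... | no  a+e≮n = inj₂ (begin
    a+e              ≡⟨ m∸n+n≡m n≤a+e ⟨
    a+e ∸ n + n      ≡⟨ cong (_+ n) (m<n⇒m%n≡m a+e∸n<n) ⟨
    (a+e ∸ n) % n + n ≡⟨ cong (_+ n) (m≤n⇒[n∸m]%m≡n%m n≤a+e) ⟩
    a+e % n + n      ≡⟨ cong (_+ n) (offset-rebase s q x) ⟨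
    offset s x + n   ∎)
    where
    open ≡-Reasoning
    a+e = offset s q + offset q x
    n≤a+e = ≮⇒≥ a+e≮n
    a+e∸n<n : a+e ∸ n < n
    a+e∸n<n = m<n+o⇒m∸n<o a+e n (+-mono-< (offset<n s q) (offset<n q x))

  -- An interval is {x | offset s x < ℓ}.  It is convex in the linear order
  -- obtained by cutting the circle at any point q outside it, and its
  -- complement is convex in the order cut at any point q inside it.
  module _ (s : Fin n) (ℓ : ℕ) (q : Fin n) where
    private
      A = offset s q

    initial-convex : ∀ {x t y} → ℓ ≤ A → offset s x < ℓ → offset s y < ℓ →
                     offset q x < offset q t → offset q t < offset q y →
                     offset s t < ℓ
    initial-convex {x} {t} {y} ℓ≤A x<ℓ y<ℓ x<t t<y
      with offset-split s q x | offset-split s q t | offset-split s q y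
    -- A walk from `q`, outside the interval, to a point inside must reach `s`, so `x` and `y` are
    -- in the second case. As `t` lies beyond `x`, it is too.
    ... | inj₁ ex | _ | _ =
      contradiction (≤-<-trans (m+n≤o⇒m≤o A (≤-reflexive ex)) x<ℓ) (≤⇒≯ ℓ≤A)
    ... | _ | _ | inj₁ ey =
      contradiction (≤-<-trans (m+n≤o⇒m≤o A (≤-reflexive ey)) y<ℓ) (≤⇒≯ ℓ≤A)
    ... | inj₂ ex | inj₁ et | inj₂ _ =
      contradiction (<-≤-trans (+-monoʳ-< A x<t) (≤-trans (≤-reflexive et) (<⇒≤ (offset<n s t))))
                    (≤⇒≯ (≤-trans (m≤n+m n (offset s x)) (≤-reflexive (sym ex))))
    ... | inj₂ _ | inj₂ et | inj₂ ey =
      <-trans (+-cancelʳ-< n _ _ (subst₂ _<_ et ey (+-monoʳ-< A t<y))) y<ℓ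

    final-convex : ∀ {x t y} → A < ℓ → ℓ ≤ offset s x → ℓ ≤ offset s y →
                   offset q x < offset q t → offset q t < offset q y →
                   ℓ ≤ offset s t
    final-convex {x} {t} {y} A<ℓ ℓ≤x ℓ≤y x<t t<y
      with offset-split s q x | offset-split s q t | offset-split s q y
    -- A walk from `q` that reaches `s` ends at a smaller offset than that of `q`, hence inside the
    -- interval. So `x` and `y` are in the first case, and so is `t`, which comes before `y`.
    ... | inj₂ ex | _ | _ =
      contradiction (<-≤-trans A<ℓ ℓ≤x)
        (<-asym (+-cancelʳ-< n _ _ (subst (_< A + n) ex (+-monoʳ-< A (offset<n q x)))))
    ... | _ | _ | inj₂ ey =
      contradiction (<-≤-trans A<ℓ ℓ≤y)
        (<-asym (+-cancelʳ-< n _ _ (subst (_< A + n) ey (+-monoʳ-< A (offset<n q y)))))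
    ... | inj₁ ex | inj₁ et | inj₁ _ =
      ≤-trans ℓ≤x (<⇒≤ (subst₂ _<_ ex et (+-monoʳ-< A x<t)))
    ... | inj₁ _ | inj₂ et | inj₁ ey =
      contradiction (<-trans (subst₂ _<_ et ey (+-monoʳ-< A t<y)) (offset<n s y))
                    (≤⇒≯ (m≤n+m n (offset s t)))

  -- Intervals of a circular ordering

  module _ (π : Permutation′ n) where

    -- The coordinate of the vertex `x` in the linear order cut at the vertex `q`, which itself gets
    -- 0.
    dist : Fin n → Fin n → ℕ
    dist q x = offset (π ⟨$⟩ˡ q) (π ⟨$⟩ˡ x)

    dist<n : ∀ q x → dist q x < n
    dist<n q x = offset<n (π ⟨$⟩ˡ q) (π ⟨$⟩ˡ x)

    walk : Fin n → ℕ → Fin n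
    walk q t = π ⟨$⟩ʳ advance (π ⟨$⟩ˡ q) t

    walk-dist : ∀ q x → walk q (dist q x) ≡ x
    walk-dist q x =
      trans (cong (π ⟨$⟩ʳ_) (advance-offset (π ⟨$⟩ˡ q) (π ⟨$⟩ˡ x))) (inverseʳ π)

    dist-walk : ∀ q {t} → t < n → dist q (walk q t) ≡ t
    dist-walk q {t} t<n = begin
      dist q (walk q t)                     ≡⟨ cong (offset (π ⟨$⟩ˡ q)) (inverseˡ π) ⟩
      offset (π ⟨$⟩ˡ q) (advance (π ⟨$⟩ˡ q) t) ≡⟨ offset-advance (π ⟨$⟩ˡ q) t ⟩
      t % n                                 ≡⟨ m<n⇒m%n≡m t<n ⟩
      t                                     ∎
      where open ≡-Reasoning

    dist-injective : ∀ q {x y} → dist q x ≡ dist q y → x ≡ y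
    dist-injective q {x} {y} eq =
      trans (sym (walk-dist q x)) (trans (cong (walk q) eq) (walk-dist q y))

    module _ {S : Pred (Fin n) 0ℓ} (I : IsInterval π S) where
      private
        s = proj₁ I
        ℓ = proj₁ (proj₂ I)

      interval⇒offset< : ∀ {x} → S x → offset s (π ⟨$⟩ˡ x) < ℓ
      interval⇒offset< {x} Sx with proj₁ (proj₂ (proj₂ I)) Sx
      ... | t , t<ℓ , refl = ≤-<-trans (begin
        offset s (π ⟨$⟩ˡ (π ⟨$⟩ʳ advance s t))  ≡⟨ cong (offset s) (inverseˡ π) ⟩
        offset s (advance s t)                  ≡⟨ offset-advance s t ⟩
        -- The length `ℓ` may exceed `n`, so `t` need not be an offset; reducing it modulo `n` keeps
        -- it below `ℓ`.
        t % n                                   ≤⟨ m%n≤m t n ⟩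
        t                                       ∎) t<ℓ
        where open ≤-Reasoning

      offset<⇒interval : ∀ {x} → offset s (π ⟨$⟩ˡ x) < ℓ → S x
      offset<⇒interval {x} o<ℓ = proj₂ (proj₂ (proj₂ I))
        (_ , o<ℓ , trans (cong (π ⟨$⟩ʳ_) (advance-offset s (π ⟨$⟩ˡ x))) (inverseʳ π))

      interval-convex : ∀ {q x t y} → ¬ S q → S x → S y →
                        Between (dist q x) (dist q t) (dist q y) → S t
      interval-convex ¬Sq Sx Sy (inj₁ (x<t , t<y)) = offset<⇒interval
        (initial-convex s ℓ _ (≮⇒≥ (¬Sq ∘ offset<⇒interval))
          (interval⇒offset< Sx) (interval⇒offset< Sy) x<t t<y)
      interval-convex ¬Sq Sx Sy (inj₂ (y<t , t<x)) =
        interval-convex ¬Sq Sy Sx (inj₁ (y<t , t<x))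

      co-interval-convex : ∀ {q x t y} → S q → ¬ S x → ¬ S y →
                           Between (dist q x) (dist q t) (dist q y) → ¬ S t
      co-interval-convex Sq ¬Sx ¬Sy (inj₁ (x<t , t<y)) St =
        contradiction (interval⇒offset< St) (≤⇒≯
          (final-convex s ℓ _ (interval⇒offset< Sq)
            (≮⇒≥ (¬Sx ∘ offset<⇒interval)) (≮⇒≥ (¬Sy ∘ offset<⇒interval)) x<t t<y))
      co-interval-convex Sq ¬Sx ¬Sy (inj₂ (y<t , t<x)) =
        co-interval-convex Sq ¬Sy ¬Sx (inj₁ (y<t , t<x))

-- Alternating marks

parity : (ℕ → Bool) → ℕ → Bool
parity m zero    = false
parity m (suc i) = m i xor parity m i

-- `parity m` counts the marked positions strictly before its argument, so from `i` to `j` only `i`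
-- itself is added.
parity-flip : ∀ m {i j} → m i ≡ true → (∀ k → i < k → k < j → m k ≡ false) →
              i < j → parity m j ≡ not (parity m i)
parity-flip m {i} {suc j} mi off (s≤s i≤j) with m≤n⇒m<n∨m≡n i≤j
... | inj₂ refl rewrite mi = refl
... | inj₁ i<j rewrite off j i<j ≤-refl =
  parity-flip m mi (λ k i<k k<j → off k i<k (m<n⇒m<1+n k<j)) i<j

mark : Bool → Bool → Fin 3
mark false _     = zero
mark true  false = suc zero
mark true  true  = suc (suc zero)

mark-injective : ∀ {a b d} → mark true a ≡ mark b d → b ≡ true × a ≡ d
mark-injective {false} {true} {false} _ = refl , refl
mark-injective {true}  {true} {true}  _ = refl , refl

-- Hitting sets of the neighborhoods

module _ {n} (G : Graph n) where
  open Graph G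

  Hit : Subset n → Fin n → Set
  Hit P v = ∃ λ u → v ~ u × u ∈ₛ P

  Hitting : Subset n → Set
  Hitting P = ∀ v → NonIsolated v → Hit P v

  PrivateNeighbor : Subset n → Fin n → Fin n → Set
  PrivateNeighbor P p u = u ~ p × (∀ x → x ∈ₛ P → u ~ x → x ≡ p)

  nonIsolated? : Decidable NonIsolated
  nonIsolated? v = any? (v ~?_)

  hit? : ∀ P → Decidable (Hit P)
  hit? P v = any? λ u → (v ~? u) ×-dec (u ∈? P)

  hitting? : Decidable Hitting
  hitting? P = all? λ v → nonIsolated? v →-dec hit? P v

  -- Some non-isolated `u` is missed once `p` is removed. As `P` meets its neighborhood, it does so
  -- in `p` alone.
  essential⇒private : ∀ {P p} → Hitting P → ¬ Hitting (P - p) →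
                      ∃ (PrivateNeighbor P p)
  essential⇒private {P} {p} hitP ¬hit
    with ¬∀⟶∃¬ n _ (λ v → nonIsolated? v →-dec hit? (P - p) v) ¬hit
  ... | u , ¬imp = u , u~p , only
    where
    only : ∀ x → x ∈ₛ P → u ~ x → x ≡ p
    only x x∈P u~x = decidable-stable (x ≟ p) λ x≢p →
      ¬imp λ _ → x , u~x , x∈p∧x≢y⇒x∈p-y x∈P x≢p

    u~p : u ~ p
    u~p with hitP u (decidable-stable (nonIsolated? u)
                      (λ iso → ¬imp λ ni → contradiction ni iso))
    ... | x , u~x , x∈P = subst (u ~_) (only x x∈P u~x) u~x

  -- A hitting set of least size works, since removing any of its points must leave some
  -- neighborhood unhit. The search is bounded by the full vertex set.
  minimal-hitting : ∃ λ P → Hitting P × (∀ p → p ∈ₛ P → ∃ (PrivateNeighbor P p))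
  minimal-hitting
    with least (λ k → anySubset? λ P → hitting? P ×-dec (∣ P ∣ ℕ.≟ k)) n
               (⊤ , (λ _ (u , v~u) → u , v~u , ∈⊤) , ∣⊤∣≡n n)
  ... | _ , (P , hitP , refl) , minimum = P , hitP , λ p p∈P →
    essential⇒private hitP λ hit →
      <⇒≱ (x∈p⇒∣p-x∣<∣p∣ p∈P) (minimum _ (P - p , hit , refl))

  -- The points `p` and `q` may coincide, which covers the case of a single point.
  HitByOneOrTwo : Subset n → Fin n → Set
  HitByOneOrTwo P v = ∃₂ λ p q → v ~ p × p ∈ₛ P × v ~ q × q ∈ₛ P ×
                      (∀ x → x ∈ₛ P → v ~ x → x ≡ p ⊎ x ≡ q)

  -- Hitting sets with private neighbors in a circular ordering

  module _ .{{_ : NonZero n}} (π : Permutation′ n)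
           (interval : ∀ v → IsInterval π (N v))
           {P : Subset n} (hitP : Hitting P)
           (private-neighbor : ∀ p → p ∈ₛ P → ∃ (PrivateNeighbor P p)) where

    -- The interval `N p` contains `v` and `u` but neither `w` nor `z`. Its complement is convex in
    -- the order cut at `v`, so `u` cannot lie between the latter two.
    private-not-between : ∀ {v p x y u w z} → v ~ p → p ∈ₛ P → x ≢ p → y ≢ p →
      PrivateNeighbor P p u → PrivateNeighbor P x w → PrivateNeighbor P y z →
      ¬ Between (dist π v w) (dist π v u) (dist π v z)
    private-not-between {p = p} v~p p∈P x≢p y≢p (u~p , _) (_ , onlyw) (_ , onlyz) b =
      co-interval-convex π (interval p) (~-sym v~p)
        (λ p~w → x≢p (sym (onlyw p p∈P (~-sym p~w))))
        (λ p~z → y≢p (sym (onlyz p p∈P (~-sym p~z))))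
        b (~-sym u~p)

    at-most-two : ∀ {v p q r} → v ~ p → p ∈ₛ P → v ~ q → q ∈ₛ P → v ~ r → r ∈ₛ P →
                  p ≢ q → r ≡ p ⊎ r ≡ q
    at-most-two {v} {p} {q} {r} v~p p∈P v~q q∈P v~r r∈P p≢q with r ≟ p | r ≟ q
    ... | yes r≡p | _ = inj₁ r≡p
    ... | _ | yes r≡q = inj₂ r≡q
    ... | no r≢p | no r≢q
      with u , pu ← private-neighbor p p∈P
         | w , pw ← private-neighbor q q∈P
         | z , pz ← private-neighbor r r∈P
      with one-between (separate p∈P pu pw p≢q) (separate q∈P pw pz (≢-sym r≢q))
                       (separate p∈P pu pz (≢-sym r≢p))
      where
      -- A vertex private to both `x` and `y` would force `x ≡ y`, so the three private neighbors
      -- are distinct and one of them is in the middle.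
      separate : ∀ {x y a b} → x ∈ₛ P → PrivateNeighbor P x a → PrivateNeighbor P y b →
                 x ≢ y → dist π v a ≢ dist π v b
      separate x∈P (a~x , _) (_ , only) x≢y eq =
        x≢y (only _ x∈P (subst (_~ _) (dist-injective π v eq) a~x))
    ... | inj₁ b = contradiction b (private-not-between v~p p∈P (≢-sym p≢q) r≢p pu pw pz)
    ... | inj₂ (inj₁ b) = contradiction b (private-not-between v~q q∈P p≢q r≢q pw pu pz)
    ... | inj₂ (inj₂ b) =
      contradiction b (private-not-between v~r r∈P (≢-sym r≢p) (≢-sym r≢q) pz pu pw)

    hit-by-one-or-two : ∀ {v} → NonIsolated v → HitByOneOrTwo P v
    hit-by-one-or-two {v} ni with hitP v ni
    ... | p , v~p , p∈P with any? (λ q → (v ~? q) ×-dec (q ∈? P) ×-dec ¬? (p ≟ q))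
    ...   | yes (q , v~q , q∈P , p≢q) = p , q , v~p , p∈P , v~q , q∈P ,
      λ x x∈P v~x → at-most-two v~p p∈P v~q q∈P v~x x∈P p≢q
    ...   | no none = p , p , v~p , p∈P , v~p , p∈P , λ x x∈P v~x →
      inj₁ (sym (decidable-stable (p ≟ x) λ p≢x → none (x , v~x , x∈P , p≢x)))

    -- A vertex of P has a neighbor, hence one in P.
    other-color : ∀ {k} {c : Coloring n k} → Proper G c → HasEdge G →
                  ∀ a → ∃ λ q → q ∈ₛ P × c q ≢ a
    other-color {c = c} proper (u , v , u~v) a with hitP u (v , u~v)
    ... | p , u~p , p∈P with c p ≟ a
    ...   | no cp≢a = p , p∈P , cp≢a
    ...   | yes refl with hitP p (u , ~-sym u~p)
    ...     | q , p~q , q∈P = q , q∈P , ≢-sym (proper p q p~q)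

    -- The refined coloring

    module _ {k} {c : Coloring n k} (proper : Proper G c)
             (base : ∀ a → ∃ λ q → q ∈ₛ P × c q ≢ a) where

      occupied : Fin k → ℕ → Bool
      occupied a i = does (walk π (proj₁ (base a)) i ∈? P)

      -- If `P` has odd size, alternation fails at one pair of circularly consecutive points. That
      -- pair contains the cut point, whose color is not `a`, so the failure does no harm to color
      -- `a`.
      side : Fin k → Fin n → Bool
      side a t = parity (occupied a) (dist π (proj₁ (base a)) t)

      -- `N v` avoids the cut point, so it contains everything between `p` and `q` in the cut order.
      -- No further point of `P` lies there, and the parity changes exactly once.
      side-flip : ∀ {v p q a} → v ~ p → p ∈ₛ P → v ~ q → q ∈ₛ P →
                  (∀ x → x ∈ₛ P → v ~ x → x ≡ p ⊎ x ≡ q) → c p ≡ a → c q ≡ a →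
                  dist π (proj₁ (base a)) p < dist π (proj₁ (base a)) q →
                  side a q ≡ not (side a p)
      side-flip {v} {p} {q} {a} v~p p∈P v~q q∈P only cp≡a cq≡a p<q =
        parity-flip (occupied a)
          (dec-true (_ ∈? P) (subst (_∈ₛ P) (sym (walk-dist π b p)) p∈P)) free p<q
        where
        b = proj₁ (base a)

        -- The cut point is in `P`, so it could be adjacent to `v` only as `p` or `q`; but these
        -- have color `a`.
        ¬v~b : ¬ v ~ b
        ¬v~b v~b with only b (proj₁ (proj₂ (base a))) v~b
        ... | inj₁ b≡p = proj₂ (proj₂ (base a)) (trans (cong c b≡p) cp≡a)
        ... | inj₂ b≡q = proj₂ (proj₂ (base a)) (trans (cong c b≡q) cq≡a)

        free : ∀ i → dist π b p < i → i < dist π b q → occupied a i ≡ false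
        free i p<i i<q = dec-false (_ ∈? P) absurd
          where
          x = walk π b i
          dist≡i : dist π b x ≡ i
          dist≡i = dist-walk π b (<-trans i<q (dist<n π b q))

          absurd : ¬ x ∈ₛ P
          absurd x∈P with only x x∈P (interval-convex π (interval v) ¬v~b v~p v~q
            (inj₁ (subst (_ <_) (sym dist≡i) p<i , subst (_< _) (sym dist≡i) i<q)))
          ... | inj₁ x≡p = <⇒≢ p<i (trans (cong (dist π b) (sym x≡p)) dist≡i)
          ... | inj₂ x≡q = <⇒≢ i<q (trans (sym dist≡i) (cong (dist π b) x≡q))

      side-injective : ∀ {v p q} → v ~ p → p ∈ₛ P → v ~ q → q ∈ₛ P →
                       (∀ x → x ∈ₛ P → v ~ x → x ≡ p ⊎ x ≡ q) → c p ≡ c q →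
                       side (c p) p ≡ side (c p) q → p ≡ q
      side-injective {p = p} {q} v~p p∈P v~q q∈P only cp≡cq eq
        with <-cmp (dist π (proj₁ (base (c p))) p) (dist π (proj₁ (base (c p))) q)
      ... | tri< p<q _ _ = contradiction
        (side-flip v~p p∈P v~q q∈P only refl (sym cp≡cq) p<q) (not-¬ (sym eq))
      ... | tri≈ _ p≡q _ = dist-injective π _ p≡q
      ... | tri> _ _ q<p = contradiction
        (side-flip v~q q∈P v~p p∈P (λ x x∈P v~x → swap (only x x∈P v~x))
                   (sym cp≡cq) refl q<p) (not-¬ eq)

      -- Every vertex uses the cut for its own color under `c`. Vertices of equal refined color
      -- agree under `c`, so their sides refer to the same cut.
      refined : Coloring n (k * 3)
      refined t = combine (c t) (mark (does (t ∈? P)) (side (c t) t))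

      refined-proper : Proper G refined
      refined-proper u v u~v eq =
        proper u v u~v (proj₁ (combine-injective (c u) _ (c v) _ eq))

      -- The mark 0 is reserved for vertices off `P`, so sharing a color with `p` already puts `t`
      -- in `P`.
      refined-injective : ∀ {p t} → p ∈ₛ P → refined t ≡ refined p →
                          t ∈ₛ P × c p ≡ c t × side (c p) p ≡ side (c p) t
      refined-injective {p} {t} p∈P eq
        with combine-injective (c p) _ (c t) _ (sym eq)
      ... | cp≡ct , m≡ rewrite dec-true (p ∈? P) p∈P | sym cp≡ct
        with t ∈? P | mark-injective m≡
      ...   | yes t∈P | _ , s≡ = t∈P , refl , s≡

      refined-conflictFree : ConflictFree G refined
      refined-conflictFree v ni with hit-by-one-or-two ni
      ... | p , q , v~p , p∈P , v~q , q∈P , only =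
        -- Only `p` and `q` can carry this color within `N v`, and if `q` does, the sides force `q`
        -- to be `p`.
        refined p , p , (v~p , refl) , unique
        where
        unique : ∀ {t} → v ~ t × refined t ≡ refined p → p ≡ t
        unique {t} (v~t , eq) with refined-injective p∈P eq
        ... | t∈P , cp≡ct , s≡ with only t t∈P v~t
        ...   | inj₁ t≡p = sym t≡p
        ...   | inj₂ refl = side-injective v~p p∈P v~q q∈P only cp≡ct s≡

-- From colorings to the bound

colorable⇒pcfColorable : ∀ {n k} (G : Graph n) → ConvexRound G → HasEdge G →
                         Colorable G k → PCFColorable G (k * 3)
colorable⇒pcfColorable G (π , interval) edge@(u , _) (c , proper)
  with minimal-hitting G
... | P , hitP , priv =
  refined G π interval hitP priv proper base ,
  refined-proper G π interval hitP priv proper base ,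
  refined-conflictFree G π interval hitP priv proper base
  where
  instance _ = nonZeroIndex u
  base = other-color G π interval hitP priv proper edge

hasEdge⇒2≤colors : ∀ {n k} (G : Graph n) → HasEdge G → Colorable G k → 2 ≤ k
hasEdge⇒2≤colors {k = zero} G (u , _) (c , _) with () ← c u
hasEdge⇒2≤colors {k = suc zero} G (u , v , u~v) (c , proper)
  with c u | c v | proper u v u~v
... | zero | zero | cu≢cv = contradiction refl cu≢cv
hasEdge⇒2≤colors {k = suc (suc k)} _ _ _ = s≤s (s≤s z≤n)

k*3≤9*k∸12 : ∀ {k} → 2 ≤ k → k * 3 ≤ 9 * k ∸ 12
k*3≤9*k∸12 {k} 2≤k = m+n≤o⇒m≤o∸n (k * 3) (begin
  -- Here 12 is read as `2 * 6`.
  k * 3 + 12       ≤⟨ +-monoʳ-≤ (k * 3) (*-monoˡ-≤ 6 2≤k) ⟩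
  k * 3 + k * 6    ≡⟨ *-distribˡ-+ k 3 6 ⟨
  k * 9            ≡⟨ *-comm k 9 ⟩
  9 * k            ∎)
  where open ≤-Reasoning

theorem1p5 : ∀ {n : ℕ} (G : Graph n) → ConvexRound G → HasEdge G →
    χpcf G ≤ 9 * χ G ∸ 12
theorem1p5 G round edge = ≤-trans
  (proj₂ (proj₂ (χpcf-least G)) _ (colorable⇒pcfColorable G round edge colorable))
  (k*3≤9*k∸12 (hasEdge⇒2≤colors G edge colorable))
  where colorable = proj₁ (proj₂ (χ-least G))
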